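{- Let $\Sigma$ be a finite alphabet, $m\ge 1$, $S\in\Sigma^m$, and let $f:\Sigma^m\to\mathbb{N}$ and $g:\Sigma^m\to\{1,\dots,m\}$ be the cost and shift functions of a window-based pattern matching algorithm $\mathcal{A}$ for pattern $S$. Let $\mathcal{D}$ be the DAA encoding $\mathcal{A}$ (defined in the context), and let $\mathcal{D}'$ be the DAA obtained from the general construction scheme (defined in the context) using a set of window representatives $\mathcal{R}$ of length $m$ that is compatible with $\mathcal{A}$ and $S$, together with an associated transition function $\delta_\mathcal{R}$. Then for every $n\ge 0$ and every text $T\in\Sigma^n$, the value computed by $\mathcal{D}$ on $T$ equals the value computed by $\mathcal{D}'$ on $T$.
   Context: A deterministic arithmetic automaton (DAA) consists of a finite state set $\mathcal{Q}$, a start state $q_0$, a transition function $\delta:\mathcal{Q}\times\Sigma\to\mathcal{Q}$, a start value $v_0=0\in\mathbb{N}$, and for each state $q$ an emission $\eta_q\in\mathbb{N}$; the value update is addition. Reading a character $\sigma$ in state $q$ with value $v$ moves to state $q'=\delta(q,\sigma)$ with value $v+\eta_{q'}$. Starting from $(q_0,0)$ and reading $T$ character by character, the value reached after reading all of $T$ is the value computed by the DAA on $T$. DAA encoding $\mathcal{A}$: states $\Sigma^m\times\{0,\dots,m\}$, start state $(S,m)$; $\delta((w,k),\sigma)=(w_1\cdots w_{m-1}\sigma,\,k-1)$ if $k>0$, and $=(w_1\cdots w_{m-1}\sigma,\,g(w)-1)$ if $k=0$ (where $w=w_0\cdots w_{m-1}$); emission $\eta_{(w,k)}=0$ if $k>0$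 and $\eta_{(w,k)}=f(w)$ if $k=0$. Representatives: for a finite set $\mathcal{R}\subset\Sigma^*$ and $a\in\Sigma^m$, $\mathrm{rep}_\mathcal{R}(a)$ is the longest suffix of $a$ (suffixes include the empty string $\varepsilon$ and $a$ itself) that lies in $\mathcal{R}$. $\mathcal{R}$ is a set of window representatives of length $m$ if (1) every $a\in\Sigma^m$ has a suffix in $\mathcal{R}$, and (2) there is $\delta_\mathcal{R}:\mathcal{R}\times\Sigma\to\mathcal{R}$ with $\delta_\mathcal{R}(\mathrm{rep}_\mathcal{R}(a),\sigma)=\mathrm{rep}_\mathcal{R}(a_1\cdots a_{m-1}\sigma)$ for all $a\in\Sigma^m,\sigma\in\Sigma$. It is compatible with $\mathcal{A}$ and $S$ if $f(a)=f(a')$ and $g(a)=g(a')$ whenever $\mathrm{rep}_\mathcal{R}(a)=\mathrm{rep}_\mathcal{R}(a')$; then for $r$ in the image of $\mathrm{rep}_\mathcal{R}$ set $f(r)=f(a)$, $g(r)=g(a)$ for any $a$ with $\mathrm{rep}_\mathcal{R}(a)=r$. General construction scheme: states $\mathcal{R}\times\{0,\dots,m\}$, start state $(\mathrm{rep}_\mathcal{R}(S),m)$; $\delta((r,k),\sigma)=(\delta_\mathcal{R}(r,\sigma),k-1)$ if $k>0$ and $=(\delta_\mathcal{R}(r,\sigma),g(r)-1)$ if $k=0$; emission $\eta_{(r,k)}=0$ if $k>0$ and $\eta_{(r,k)}=f(r)$ if $k=0$. -}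

module Defs where

open import Data.Empty using (⊥-elim)
open import Data.Fin.Base using (Fin; zero; suc; fromℕ; fromℕ<; inject₁)
open import Data.Fin.Properties using (*↔×; 1↔⊤; any?; inj⇒≟)
open import Data.List.Base as List using (List; []; _∷_; length)
open import Data.List.Membership.Propositional using (_∈_)
open import Data.List.Membership.Propositional.Properties using (∈-lookup)
open import Data.List.Properties using (≡-dec)
open import Data.List.Relation.Binary.Pointwise using (Pointwise-≡⇒≡; ≡⇒Pointwise-≡)
open import Data.List.Relation.Binary.Suffix.Heterogeneous using (Suffix; here; there)
open import Data.List.Relation.Binary.Suffix.Heterogeneous.Properties using (length-mono)
open import Data.List.Relation.Unary.Any as Any using (index)
open import Data.List.Relation.Unary.Unique.Propositional using (Unique)
import Data.List.Membership.DecPropositional as DecMembership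
open import Data.Nat.Base using (ℕ; zero; suc; _+_; _*_; _≤_; s≤s)
open import Data.Nat.Properties using (≤-trans; pred[n]≤n)
open import Data.Product.Base using (Σ; ∃; _×_; _,_; proj₁; proj₂; uncurry)
open import Data.Product.Function.NonDependent.Propositional using (_×-↔_)
open import Data.Unit.Base using (⊤; tt)
open import Data.Vec.Base using (Vec; []; _∷_; tail; _∷ʳ_; toList; foldl′)
open import Function.Base using (_∘_)
open import Function.Bundles using (_↔_; mk↔ₛ′; Inverse)
open import Function.Construct.Composition using (_↔-∘_)
open import Function.Construct.Symmetry using (↔-sym)
open import Function.Properties.Inverse using (↔⇒↣)
open import Relation.Binary.Definitions using (DecidableEquality)
open import Relation.Binary.PropositionalEquality using (_≡_; refl; sym; subst; cong)
open import Relation.Nullary.Decidable using (Dec; yes; no; map′)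
open import Relation.Unary using (Decidable)

Finite : Set → Set
Finite X = ∃ λ n → X ↔ Fin n

finite-≟ : ∀ {X} → Finite X → DecidableEquality X
finite-≟ (_ , X↔n) = inj⇒≟ (↔⇒↣ X↔n)

finite-any? : ∀ {X} → Finite X → {P : X → Set} → Decidable P → Dec (∃ P)
finite-any? (_ , X↔n) {P} P? =
  map′ (λ (i , p) → from i , p)
       (λ (x , p) → to x , subst P (sym (strictlyInverseʳ x)) p)
       (any? (P? ∘ from))
  where open Inverse X↔n

finite-Fin : ∀ n → Finite (Fin n)
finite-Fin n = n , mk↔ₛ′ (λ i → i) (λ i → i) (λ _ → refl) (λ _ → refl)

finite-× : ∀ {X Y} → Finite X → Finite Y → Finite (X × Y)
finite-× (m , X↔m) (n , Y↔n) = m * n , (↔-sym *↔× ↔-∘ (X↔m ×-↔ Y↔n))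

finite-Vec : ∀ {X} → Finite X → ∀ m → Finite (Vec X m)
finite-Vec finX zero =
  1 , (↔-sym 1↔⊤ ↔-∘ mk↔ₛ′ (λ _ → tt) (λ _ → []) (λ _ → refl) (λ { [] → refl }))
finite-Vec finX (suc m) with finite-× finX (finite-Vec finX m)
... | n , X×V↔n = n , (X×V↔n ↔-∘
  mk↔ₛ′ (λ { (x ∷ xs) → x , xs }) (uncurry _∷_) (λ _ → refl) (λ { (_ ∷ _) → refl }))

-- Listing each member exactly once makes membership proofs unique, so that
-- equality in Elem R is equality of the underlying members.
record FiniteSubset (X : Set) : Set where
  field
    members : List X
    unique  : Unique members

open FiniteSubset public using (members)

Elem : ∀ {X} → FiniteSubset X → Set
Elem R = ∃ λ x → x ∈ members R

finite-Elem : ∀ {X} (R : FiniteSubset X) → Finite (Elem R)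
finite-Elem {X} R = length (members R) , mk↔ₛ′
  (index ∘ proj₂)
  (λ i → List.lookup (members R) i , ∈-lookup i)
  (index-∈-lookup (members R))
  (λ (_ , x∈xs) → lookup-index x∈xs)
  where
  index-∈-lookup : ∀ (xs : List X) i → index (∈-lookup {xs = xs} i) ≡ i
  index-∈-lookup (x ∷ xs) zero    = refl
  index-∈-lookup (x ∷ xs) (suc i) = cong suc (index-∈-lookup xs i)

  lookup-index : ∀ {x} {xs : List X} (x∈xs : x ∈ xs) →
    _≡_ {A = ∃ (_∈ xs)} (List.lookup xs (index x∈xs) , ∈-lookup (index x∈xs)) (x , x∈xs)
  lookup-index (Any.here refl)  = refl
  lookup-index (Any.there x∈xs) = cong (λ (x , p) → x , Any.there p) (lookup-index x∈xs)

-- Deterministic arithmetic automata with values in ℕ, start value 0 and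
-- addition as the value update.
record DAA (A : Set) : Set₁ where
  field
    State  : Set
    finite : Finite State
    start  : State
    δ      : State → A → State
    η      : State → ℕ

module _ {A : Set} (D : DAA A) where
  open DAA D

  step : State × ℕ → A → State × ℕ
  step (q , v) σ = δ q σ , v + η (δ q σ)

  value : ∀ {n} → Vec A n → ℕ
  value T = proj₂ (foldl′ step (start , 0) T)

-- The set {1, …, m}.
Shift : ℕ → Set
Shift m = Σ ℕ λ s → 1 ≤ s × s ≤ m

-- s ↦ s - 1, from {1, …, m} to {0, …, m}.
minusOne : ∀ {m} → Shift m → Fin (suc m)
minusOne (s , _ , s≤m) = fromℕ< (s≤s (≤-trans (pred[n]≤n {s}) s≤m))

record WindowAlgorithm (A : Set) (m : ℕ) : Set where
  field
    S : Vec A m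
    f : Vec A m → ℕ
    g : Vec A m → Shift m

-- w₀ ⋯ wₘ₋₁ ↦ w₁ ⋯ wₘ₋₁ σ
slide : ∀ {A : Set} {m} → Vec A m → A → Vec A m
slide w σ = tail (w ∷ʳ σ)

-- inject₁ k : Fin (suc m) is the predecessor of suc k : Fin (suc m).
encodingDAA : ∀ {A m} → Finite A → WindowAlgorithm A m → DAA A
encodingDAA {A} {m} finA 𝒜 = record
  { State  = Vec A m × Fin (suc m)
  ; finite = finite-× (finite-Vec finA m) (finite-Fin (suc m))
  ; start  = S , fromℕ m
  ; δ      = λ { (w , suc k) σ → slide w σ , inject₁ k
               ; (w , zero)  σ → slide w σ , minusOne (g w) }
  ; η      = λ { (w , suc k) → 0
               ; (w , zero)  → f w }
  }
  where open WindowAlgorithm 𝒜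

HasSuffixIn : ∀ {A : Set} → FiniteSubset (List A) → List A → Set
HasSuffixIn R a = ∃ λ r → r ∈ members R × Suffix _≡_ r a

record IsLongestSuffixIn {A : Set} (R : FiniteSubset (List A)) (a r : List A) : Set where
  field
    member  : r ∈ members R
    suffix  : Suffix _≡_ r a
    longest : ∀ {s} → s ∈ members R → Suffix _≡_ s a → length s ≤ length r

longestSuffixIn : ∀ {A} → Finite A → (R : FiniteSubset (List A)) →
                  ∀ a → HasSuffixIn R a → ∃ (IsLongestSuffixIn R a)
longestSuffixIn {A} finA R = go
  where
  open DecMembership (≡-dec (finite-≟ finA)) using (_∈?_)

  go : ∀ a → HasSuffixIn R a → ∃ (IsLongestSuffixIn R a)
  go a h with a ∈? members R
  go a h | yes a∈R = a , record
    { member  = a∈R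
    ; suffix  = here (≡⇒Pointwise-≡ refl)
    ; longest = λ _ → length-mono
    }
  go a (r , r∈R , here r≡a) | no a∉R =
    ⊥-elim (a∉R (subst (_∈ members R) (Pointwise-≡⇒≡ r≡a) r∈R))
  go (x ∷ a) (r , r∈R , there suf) | no a∉R with go a (r , r∈R , suf)
  ... | t , t-longest = t , record
    { member  = member
    ; suffix  = there suffix
    ; longest = λ { s∈R (here s≡a)  → ⊥-elim (a∉R (subst (_∈ members R) (Pointwise-≡⇒≡ s≡a) s∈R))
                  ; s∈R (there suf) → longest s∈R suf }
    }
    where open IsLongestSuffixIn t-longest

Covers : ∀ {A : Set} → FiniteSubset (List A) → ℕ → Set
Covers {A} R m = (a : Vec A m) → HasSuffixIn R (toList a)

rep : ∀ {A m} → Finite A → (R : FiniteSubset (List A)) → Covers R m → Vec A m → Elem R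
rep finA R covers a with longestSuffixIn finA R (toList a) (covers a)
... | r , r-longest = r , IsLongestSuffixIn.member r-longest

IsTransition : ∀ {A m} → Finite A → (R : FiniteSubset (List A)) → Covers R m →
               (Elem R → A → Elem R) → Set
IsTransition finA R covers δR =
  ∀ a σ → δR (rep finA R covers a) σ ≡ rep finA R covers (slide a σ)

record IsWindowRepresentatives {A : Set} (finA : Finite A) (m : ℕ)
                               (R : FiniteSubset (List A)) : Set where
  field
    covers     : Covers R m
    transition : ∃ (IsTransition finA R covers)

record Compatible {A : Set} {m : ℕ} (finA : Finite A) (𝒜 : WindowAlgorithm A m)
                  (R : FiniteSubset (List A)) (covers : Covers R m) : Set where
  open WindowAlgorithm 𝒜
  field
    f-compatible : ∀ a a′ → rep finA R covers a ≡ rep finA R covers a′ → f a ≡ f a′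
    g-compatible : ∀ a a′ → rep finA R covers a ≡ rep finA R covers a′ → g a ≡ g a′

-- h(r) = h(a) for some window a with rep a = r.  On an r that represents no
-- window h(r) is not determined by h, and the value off r is used.
onRepresentatives : ∀ {A m} {B : Set} → Finite A → (R : FiniteSubset (List A)) → Covers R m →
                    (h : Vec A m → B) (off : Elem R → B) → Elem R → B
onRepresentatives {m = m} finA R covers h off r
  with finite-any? (finite-Vec finA m)
                   (λ a → finite-≟ (finite-Elem R) (rep finA R covers a) r)
... | yes (a , _) = h a
... | no  _       = off r

-- fOff and gOff are the values of f and g on the elements of R that represent
-- no window; the construction leaves them open.
schemeDAA : ∀ {A m} → Finite A → WindowAlgorithm A m →
            (R : FiniteSubset (List A)) → Covers R m → (δR : Elem R → A → Elem R) →
            (fOff : Elem R → ℕ) (gOff : Elem R → Shift m) → DAA A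
schemeDAA {A} {m} finA 𝒜 R covers δR fOff gOff = record
  { State  = Elem R × Fin (suc m)
  ; finite = finite-× (finite-Elem R) (finite-Fin (suc m))
  ; start  = rep finA R covers S , fromℕ m
  ; δ      = λ { (r , suc k) σ → δR r σ , inject₁ k
               ; (r , zero)  σ → δR r σ , minusOne (gR r) }
  ; η      = λ { (r , suc k) → 0
               ; (r , zero)  → fR r }
  }
  where
  open WindowAlgorithm 𝒜

  fR : Elem R → ℕ
  fR = onRepresentatives finA R covers f fOff

  gR : Elem R → Shift m
  gR = onRepresentatives finA R covers g gOff

{-# OPTIONS --safe #-}

-- The map (w , k) ↦ (rep w , k) is a homomorphism of automata that preserves
-- start state, transitions and emissions; such a homomorphism preserves values.
module Submission where

open import Defs
open import Data.Fin.Base using (zero; suc)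
open import Data.List.Base using (List)
open import Data.Nat.Base using (ℕ; _≤_; _+_)
open import Data.Product.Base using (_,_; proj₂; map₁)
open import Data.Vec.Base using (Vec; []; _∷_; foldl′)
open import Relation.Binary.PropositionalEquality using (_≡_; refl; sym; trans; cong; cong₂)
open import Relation.Nullary.Decidable using (yes; no)
open import Relation.Nullary.Negation using (contradiction)

-- Passing from a window to its representative keeps all that a run depends on. Compatibility says
-- that `f` and `g` factor through `rep`, and the transition law says that `rep` commutes with
-- sliding the window. So the run of the encoding automaton is carried, state by state, to the run
-- of the scheme, with equal emissions and hence equal sums. `onRepresentatives-rep` supplies the
-- factorisation and `run-homo` the induction on the text.

record DAAHomomorphism {A : Set} (D D′ : DAA A) : Set where
  private
    module D  = DAA D
    module D′ = DAA D′
  field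
    ⟦_⟧     : D.State → D′.State
    start-≡ : ⟦ D.start ⟧ ≡ D′.start
    δ-≡     : ∀ q σ → ⟦ D.δ q σ ⟧ ≡ D′.δ ⟦ q ⟧ σ
    η-≡     : ∀ q → D.η q ≡ D′.η ⟦ q ⟧

module _ {A : Set} {D D′ : DAA A} (φ : DAAHomomorphism D D′) where
  open DAAHomomorphism φ

  step-homo : ∀ qv σ → map₁ ⟦_⟧ (step D qv σ) ≡ step D′ (map₁ ⟦_⟧ qv) σ
  step-homo (q , v) σ = cong₂ _,_ (δ-≡ q σ)
    -- The value added is the emission of the state entered, so `η-≡` is applied at the target state
    -- and then transported along `δ-≡`.
    (cong (v +_) (trans (η-≡ _) (cong (DAA.η D′) (δ-≡ q σ))))

  -- The initial pair is arbitrary because the left fold advances it with every character.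
  run-homo : ∀ {n} qv (T : Vec A n) →
             map₁ ⟦_⟧ (foldl′ (step D) qv T) ≡ foldl′ (step D′) (map₁ ⟦_⟧ qv) T
  run-homo qv []      = refl
  run-homo qv (σ ∷ T) = trans (run-homo (step D qv σ) T)
    (cong (λ qv′ → foldl′ (step D′) qv′ T) (step-homo qv σ))

  value-homo : ∀ {n} (T : Vec A n) → value D T ≡ value D′ T
  value-homo T = trans (cong proj₂ (run-homo (DAA.start D , 0) T))
    (cong (λ q → proj₂ (foldl′ (step D′) (q , 0) T)) start-≡)

-- The search may return a window other than `w`; both have the same representative, so `h` agrees
-- on them.
onRepresentatives-rep :
  ∀ {A m} {B : Set} (finA : Finite A) (R : FiniteSubset (List A)) (covers : Covers R m)
    (h : Vec A m → B) (off : Elem R → B) →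
  (∀ a a′ → rep finA R covers a ≡ rep finA R covers a′ → h a ≡ h a′) →
  ∀ w → h w ≡ onRepresentatives finA R covers h off (rep finA R covers w)
onRepresentatives-rep {m = m} finA R covers h off h-compatible w
  with finite-any? (finite-Vec finA m)
         (λ a → finite-≟ (finite-Elem R) (rep finA R covers a) (rep finA R covers w))
... | yes (a , rep-a≡rep-w) = h-compatible w a (sym rep-a≡rep-w)
-- The search cannot fail, as `w` itself is a witness.
... | no  ∄a                = contradiction (w , refl) ∄a

rep-homomorphism :
  ∀ {A m} (finA : Finite A) (𝒜 : WindowAlgorithm A m)
    (R : FiniteSubset (List A)) (covers : Covers R m) → Compatible finA 𝒜 R covers →
  ∀ (δR : Elem R → A → Elem R) → IsTransition finA R covers δR →
  ∀ (fOff : Elem R → ℕ) (gOff : Elem R → Shift m) →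
  DAAHomomorphism (encodingDAA finA 𝒜) (schemeDAA finA 𝒜 R covers δR fOff gOff)
rep-homomorphism finA 𝒜 R covers compatible δR isTransition fOff gOff = record
  { ⟦_⟧     = map₁ (rep finA R covers)
  ; start-≡ = refl
  ; δ-≡     = λ { (w , suc k) σ → cong (_, _) (sym (isTransition w σ))
                -- The new counter is computed from the window before the slide, so `g` is compared
                -- at `w`.
                ; (w , zero)  σ → cong₂ _,_ (sym (isTransition w σ))
                    (cong minusOne (onRepresentatives-rep finA R covers g gOff g-compatible w)) }
  ; η-≡     = λ { (w , suc k) → refl
                ; (w , zero)  → onRepresentatives-rep finA R covers f fOff f-compatible w }
  }
  where
  open WindowAlgorithm 𝒜
  open Compatible compatible

theorem15 : ∀ (A : Set) (finA : Finite A) (m : ℕ) → 1 ≤ m →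
    ∀ (𝒜 : WindowAlgorithm A m) (R : FiniteSubset (List A))
    (isRep : IsWindowRepresentatives finA m R) →
    let covers = IsWindowRepresentatives.covers isRep in
    Compatible finA 𝒜 R covers →
    ∀ (δR : Elem R → A → Elem R) → IsTransition finA R covers δR →
    ∀ (fOff : Elem R → ℕ) (gOff : Elem R → Shift m) →
    ∀ (n : ℕ) (T : Vec A n) →
    value (encodingDAA finA 𝒜) T ≡ value (schemeDAA finA 𝒜 R covers δR fOff gOff) T
theorem15 A finA m _ 𝒜 R isRep compatible δR isTransition fOff gOff n T =
  value-homo (rep-homomorphism finA 𝒜 R (IsWindowRepresentatives.covers isRep)
                compatible δR isTransition fOff gOff) T
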